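{- Let $(Co_{\mathbf{K}},i)$ be an equational filter pair over $\Sigma$, with $i$ given by the equations $\delta(x)\approx\epsilon(x)$. Then for every $\Sigma$-structure $A$ the left adjoint $\Xi_A$ of $i_A$ maps $S\subseteq A$ to the $\mathbf{K}$-congruence generated by $\{\langle\delta^A(s),\epsilon^A(s)\rangle\mid s\in S\}$ (with $\delta\approx\epsilon$ ranging over the given equations), i.e. to the smallest element of $Co_{\mathbf{K}}(A)$ containing this set.
   Context: A quasivariety is a class of $\Sigma$-structures axiomatizable by quasi-identities. $Co_{\mathbf{K}}(A)$ is the complete lattice, ordered by inclusion, of congruences $\theta$ on $A$ with $A/\theta\in\mathbf{K}$ ($\mathbf{K}$-congruences). An equational filter pair is a pair $(Co_{\mathbf{K}},i)$ with $\mathbf{K}$ a quasivariety and $i_A:Co_{\mathbf{K}}(A)\to\mathcal{P}(A)$, $i_A(\theta)=\{a\in A\mid\langle\delta^A(a),\epsilon^A(a)\rangle\in\theta$ for all $\delta\approx\epsilon\in\tau\}$ for every $\Sigma$-structure $A$, where $\tau$ is a fixed finite set of equations in at most one variable ("$i$ is given by $\tau$"). Since $i_A$ preserves arbitrary infima it has a left adjoint $\Xi_A:\mathcal{P}(A)\to Co_{\mathbf{K}}(A)$, characterized by $\Xi_A(S)\subseteq\theta\iff S\subseteq i_A(\theta)$. -}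

module Defs where

open import Level using (Level; _⊔_) renaming (suc to lsuc)
open import Data.Nat.Base using (ℕ)
open import Data.Unit.Base using (⊤)
open import Data.Product.Base using (_×_; _,_; Σ-syntax; ∃-syntax)
open import Data.List.Base using (List)
open import Data.List.Relation.Unary.All using (All)
open import Data.List.Membership.Propositional using () renaming (_∈_ to _∈ˡ_)
open import Data.Vec.Functional using (Vector)
open import Function.Bundles using (_⇔_)
open import Relation.Unary using (Pred; _∈_; _⊆_)
open import Relation.Binary.Core using (Rel; _⇒_)
open import Relation.Binary.Bundles using (Setoid)
open import Relation.Binary.Definitions using (_Respects_; Adjoint)
open import Relation.Binary.Structures using (IsEquivalence)

private
  variable
    ℓ k : Level

-- Conventions.  "Sets" are the types of one arbitrary universe `Set ℓ`, and
-- structures are carried by setoids, so that A / θ is the carrier of A with θ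
-- as its equality.  Accordingly congruences contain the equality of A, and
-- subsets of A respect it.

-- Finitary algebraic signatures: a set of operation symbols for each arity.
Signature : (ℓ : Level) → Set (lsuc ℓ)
Signature ℓ = ℕ → Set ℓ

record Structure (Sg : Signature ℓ) : Set (lsuc ℓ) where
  field
    setoid : Setoid ℓ ℓ
  open Setoid setoid public
  field
    ⟪_⟫     : ∀ {n} → Sg n → Vector Carrier n → Carrier
    ⟪⟫-cong : ∀ {n} (f : Sg n) {u v : Vector Carrier n} →
              (∀ j → u j ≈ v j) → ⟪ f ⟫ u ≈ ⟪ f ⟫ v

data Term (Sg : Signature ℓ) (X : Set) : Set ℓ where
  var : X → Term Sg X
  app : ∀ {n} → Sg n → Vector (Term Sg X) n → Term Sg X

Equation : Signature ℓ → Set → Set ℓ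
Equation Sg X = Term Sg X × Term Sg X

-- A quasi-identity  e₁ ∧ … ∧ eₙ ⟶ e,  implicitly universally quantified;
-- n = 0 (an identity) is allowed.
record QuasiIdentity (Sg : Signature ℓ) : Set ℓ where
  field
    premises   : List (Equation Sg ℕ)
    conclusion : Equation Sg ℕ

module _ {Sg : Signature ℓ} where

  module _ (A : Structure Sg) where
    open Structure A

    eval : {X : Set} → (X → Carrier) → Term Sg X → Carrier
    eval ρ (var x)    = ρ x
    eval ρ (app f ts) = ⟪ f ⟫ (λ j → eval ρ (ts j))

    eval-cong : {X : Set} {ρ σ : X → Carrier} → (∀ x → ρ x ≈ σ x) →
                ∀ t → eval ρ t ≈ eval σ t
    eval-cong ρ≈σ (var x)    = ρ≈σ x
    eval-cong ρ≈σ (app f ts) = ⟪⟫-cong f (λ j → eval-cong ρ≈σ (ts j))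

    eval₁ : Term Sg ⊤ → Carrier → Carrier
    eval₁ t a = eval (λ _ → a) t

    Holds : {X : Set} → (X → Carrier) → Equation Sg X → Set ℓ
    Holds ρ (s , t) = eval ρ s ≈ eval ρ t

    Satisfies : QuasiIdentity Sg → Set ℓ
    Satisfies q = ∀ (ρ : ℕ → Carrier) → All (Holds ρ) premises → Holds ρ conclusion
      where open QuasiIdentity q

    record Subset : Set (lsuc ℓ) where
      field
        member   : Pred Carrier ℓ
        respects : member Respects _≈_

    _⊆ₛ_ : Rel Subset ℓ
    S ⊆ₛ T = Subset.member S ⊆ Subset.member T

    record Congruence : Set (lsuc ℓ) where
      field
        rel           : Rel Carrier ℓ
        isEquivalence : IsEquivalence rel
        ≈⇒rel         : _≈_ ⇒ rel
        compatible    : ∀ {n} (f : Sg n) {u v : Vector Carrier n} →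
                        (∀ j → rel (u j) (v j)) → rel (⟪ f ⟫ u) (⟪ f ⟫ v)

  _/_ : (A : Structure Sg) → Congruence A → Structure Sg
  A / θ = record
    { setoid  = record { isEquivalence = Congruence.isEquivalence θ }
    ; ⟪_⟫     = Structure.⟪_⟫ A
    ; ⟪⟫-cong = Congruence.compatible θ
    }

  IsQuasivariety : Pred (Structure Sg) k → Set (lsuc ℓ ⊔ k)
  IsQuasivariety K =
    Σ[ Q ∈ Pred (QuasiIdentity Sg) ℓ ]
      (∀ A → A ∈ K ⇔ (∀ q → q ∈ Q → Satisfies A q))

  record Co (K : Pred (Structure Sg) k) (A : Structure Sg) : Set (lsuc ℓ ⊔ k) where
    field
      congruence : Congruence A
      quotient∈K : (A / congruence) ∈ K
    open Congruence congruence public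

  module _ {K : Pred (Structure Sg) k} {A : Structure Sg} where
    open Structure A using (Carrier)

    _≤ᶜ_ : Rel (Co K A) ℓ
    θ ≤ᶜ ψ = Co.rel θ ⇒ Co.rel ψ

    -- θ is the K-congruence generated by R: the smallest element of Co K A
    -- containing R.
    IsGeneratedBy : Co K A → Rel Carrier ℓ → Set (lsuc ℓ ⊔ k)
    IsGeneratedBy θ R = (R ⇒ Co.rel θ) × (∀ ψ → R ⇒ Co.rel ψ → θ ≤ᶜ ψ)

-- The map i of the pair is determined by τ, so only τ is stored.
record EquationalFilterPair (Sg : Signature ℓ) (k : Level) : Set (lsuc (ℓ ⊔ k)) where
  field
    K              : Pred (Structure Sg) k
    isQuasivariety : IsQuasivariety K
    τ              : List (Equation Sg ⊤)

  module _ (A : Structure Sg) where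
    open Structure A

    i : Co K A → Subset A
    i θ = record
      { member   = λ a → ∀ {δ ε} → (δ , ε) ∈ˡ τ → rel (eval₁ A δ a) (eval₁ A ε a)
      ; respects = λ a≈b a∈ {δ} {ε} e∈τ →
          E.trans (E.sym (≈⇒rel (eval-cong A (λ _ → a≈b) δ)))
            (E.trans (a∈ e∈τ) (≈⇒rel (eval-cong A (λ _ → a≈b) ε)))
      }
      where
        open Co θ
        module E = IsEquivalence (Co.isEquivalence θ)

    IsLeftAdjoint : (Subset A → Co K A) → Set (lsuc ℓ ⊔ k)
    IsLeftAdjoint Ξ = Adjoint (_⊆ₛ_ A) _≤ᶜ_ Ξ i

    -- { ⟨δ(s), ε(s)⟩ ∣ s ∈ S, δ ≈ ε in τ }, as a subset of the setoid A × A.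
    τ-pairs : Subset A → Rel Carrier ℓ
    τ-pairs S x y =
      ∃[ s ] ∃[ δ ] ∃[ ε ]
        Subset.member S s × (δ , ε) ∈ˡ τ × x ≈ eval₁ A δ s × y ≈ eval₁ A ε s

{-# OPTIONS --safe #-}

-- For a K-congruence ψ, both S ⊆ i ψ and τ-pairs S ⊆ ψ say that ψ identifies
-- δ(s) and ε(s) for all s ∈ S.  Hence the smallest K-congruence containing
-- τ-pairs S has the universal property of Ξ S, and conversely.  An intersection
-- of all K-congruences would leave the universe Set ℓ, so existence is obtained
-- by closing inductively under the axioms of K.
module Submission where

open import Level using (Level)
open import Data.Product.Base using (_×_; Σ-syntax; _,_; proj₁; proj₂)
open import Data.Nat.Base using (ℕ)
open import Data.List.Relation.Unary.All as All using (All; []; _∷_)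
open import Data.Vec.Functional using (Vector)
open import Function.Base using (id)
open import Function.Bundles using (_⇔_; mk⇔; module Equivalence)
open import Relation.Unary using (Pred; _∈_)
open import Relation.Binary.Core using (Rel; _⇒_)
open import Relation.Binary.Structures using (IsEquivalence)
open import Defs

module _ {ℓ : Level} {Sg : Signature ℓ} {A : Structure Sg} where
  open Structure A

  -- The operations of `A / θ` are those of `A`, but `eval` reduces only on constructors, so
  -- comparing the two evaluations takes an induction on the term.
  eval-/ : (θ : Congruence A) {X : Set} (ρ : X → Carrier) (t : Term Sg X) →
           eval (A / θ) ρ t ≈ eval A ρ t
  eval-/ θ ρ (var x)    = refl
  eval-/ θ ρ (app f ts) = ⟪⟫-cong f (λ j → eval-/ θ ρ (ts j))

  -- Stated for a bare relation, so that the premises of `quasi` can mention `Closure` before it is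
  -- known to be a congruence.
  HoldsIn : {X : Set} → Rel Carrier ℓ → (X → Carrier) → Equation Sg X → Set ℓ
  HoldsIn R ρ e = R (eval A ρ (proj₁ e)) (eval A ρ (proj₂ e))

  Holds-/ : (θ : Congruence A) {X : Set} (ρ : X → Carrier) (e : Equation Sg X) →
            Holds (A / θ) ρ e ⇔ HoldsIn (Congruence.rel θ) ρ e
  Holds-/ θ ρ (s , t) = mk⇔
    (λ p → E.trans (E.sym s≈) (E.trans p t≈))
    (λ p → E.trans s≈ (E.trans p (E.sym t≈)))
    where
      module E = IsEquivalence (Congruence.isEquivalence θ)
      s≈ = Congruence.≈⇒rel θ (eval-/ θ ρ s)
      t≈ = Congruence.≈⇒rel θ (eval-/ θ ρ t)

  module _ (Q : Pred (QuasiIdentity Sg) ℓ) (R : Rel Carrier ℓ) where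
    open QuasiIdentity

    data Closure : Rel Carrier ℓ where
      base  : R ⇒ Closure
      equal : _≈_ ⇒ Closure
      symᶜ  : ∀ {x y} → Closure x y → Closure y x
      trᶜ   : ∀ {x y z} → Closure x y → Closure y z → Closure x z
      congᶜ : ∀ {n} (f : Sg n) {u v : Vector Carrier n} →
              (∀ j → Closure (u j) (v j)) → Closure (⟪ f ⟫ u) (⟪ f ⟫ v)
      quasi : ∀ {q} → q ∈ Q → (ρ : ℕ → Carrier) →
              All (HoldsIn Closure ρ) (premises q) →
              HoldsIn Closure ρ (conclusion q)

    closure : Congruence A
    closure = record
      { rel           = Closure
      ; isEquivalence = record { refl = equal refl ; sym = symᶜ ; trans = trᶜ }
      ; ≈⇒rel         = equal
      ; compatible    = congᶜ
      }

    -- The quotient keeps the carrier, so its valuations are valuations in `A`, and `quasi` covers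
    -- all of them.
    closure-satisfies : ∀ q → q ∈ Q → Satisfies (A / closure) q
    closure-satisfies q q∈Q ρ ps =
      Equivalence.from (Holds-/ closure ρ (conclusion q))
        (quasi q∈Q ρ (All.map (λ {e} → Equivalence.to (Holds-/ closure ρ e)) ps))

    module _ (ψ : Congruence A) (sat : ∀ q → q ∈ Q → Satisfies (A / ψ) q)
             (R⇒ψ : R ⇒ Congruence.rel ψ) where
      private
        module ψ = Congruence ψ
        module E = IsEquivalence ψ.isEquivalence

      -- Induction on derivations: `ψ` is closed under each rule, under `quasi` because `A / ψ`
      -- satisfies `Q`.
      closure-least     : Closure ⇒ ψ.rel
      -- Explicit recursion instead of `All.map` keeps the calls on premises visibly structural for
      -- the termination checker.
      closure-least-All : ∀ {ρ es} → All (HoldsIn Closure ρ) es →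
                          All (Holds (A / ψ) {ℕ} ρ) es

      closure-least (base r)     = R⇒ψ r
      closure-least (equal p)    = ψ.≈⇒rel p
      closure-least (symᶜ p)     = E.sym (closure-least p)
      closure-least (trᶜ p p′)   = E.trans (closure-least p) (closure-least p′)
      closure-least (congᶜ f ps) = ψ.compatible f (λ j → closure-least (ps j))
      closure-least (quasi {q} q∈Q ρ ps) =
        Equivalence.to (Holds-/ ψ ρ (conclusion q))
          (sat q q∈Q ρ (closure-least-All ps))

      closure-least-All []                     = []
      closure-least-All {ρ} (_∷_ {x = e} p ps) =
        Equivalence.from (Holds-/ ψ ρ e) (closure-least p) ∷ closure-least-All ps

  -- Both directions of the axiomatization matter: one puts the quotient by the closure into `K`,
  -- the other makes every competing `ψ` closed under `quasi`.
  generated : ∀ {k} {K : Pred (Structure Sg) k} → IsQuasivariety K →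
              (R : Rel Carrier ℓ) → Σ[ θ ∈ Co K A ] IsGeneratedBy θ R
  generated (Q , K⇔Q) R =
    record
      { congruence = closure Q R
      ; quotient∈K = Equivalence.from (K⇔Q _) (closure-satisfies Q R)
      }
    , base
    , λ ψ → closure-least Q R (Co.congruence ψ)
              (Equivalence.to (K⇔Q _) (Co.quotient∈K ψ))

module _ {ℓ k : Level} {Sg : Signature ℓ} (P : EquationalFilterPair Sg k)
         (A : Structure Sg) where
  open EquationalFilterPair P
  open Structure A

  τ-pairs⇒⇔⊆i : ∀ S (ψ : Co K A) →
                (τ-pairs A S ⇒ Co.rel ψ) ⇔ (_⊆ₛ_ A S (i A ψ))
  τ-pairs⇒⇔⊆i S ψ = mk⇔ to from
    where
      module E = IsEquivalence (Co.isEquivalence ψ)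

      to : τ-pairs A S ⇒ Co.rel ψ → _⊆ₛ_ A S (i A ψ)
      to R⇒ψ s∈S e∈τ = R⇒ψ (_ , _ , _ , s∈S , e∈τ , refl , refl)

      from : _⊆ₛ_ A S (i A ψ) → τ-pairs A S ⇒ Co.rel ψ
      from S⊆iψ (_ , _ , _ , s∈S , e∈τ , x≈ , y≈) =
        -- `x` and `y` equal the two term values only up to `≈`, which `ψ` absorbs.
        E.trans (Co.≈⇒rel ψ x≈)
          (E.trans (S⊆iψ s∈S e∈τ) (E.sym (Co.≈⇒rel ψ y≈)))

  generated⇒adjoint : (Ξ : Subset A → Co K A) →
                      (∀ S → IsGeneratedBy (Ξ S) (τ-pairs A S)) →
                      IsLeftAdjoint A Ξ
  generated⇒adjoint Ξ gen {S} {ψ} =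
    (λ ΞS≤ψ → to (λ r → ΞS≤ψ (proj₁ (gen S) r))) ,
    (λ S⊆iψ → proj₂ (gen S) ψ (from S⊆iψ))
    where open Equivalence (τ-pairs⇒⇔⊆i S ψ)

  adjoint⇒generated : (Ξ : Subset A → Co K A) → IsLeftAdjoint A Ξ →
                      ∀ S → IsGeneratedBy (Ξ S) (τ-pairs A S)
  adjoint⇒generated Ξ adj S =
    -- Reflexivity of `≤ᶜ` at `Ξ S` yields the unit of the adjunction, `S` inside `i (Ξ S)`.
    Equivalence.from (τ-pairs⇒⇔⊆i S (Ξ S)) (proj₁ (adj {S} {Ξ S}) id) ,
    λ ψ R⇒ψ → proj₂ (adj {S} {ψ}) (Equivalence.to (τ-pairs⇒⇔⊆i S ψ) R⇒ψ)

proposition4p2 : ∀ {ℓ k : Level} {Sg : Signature ℓ} (P : EquationalFilterPair Sg k) →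
    let open EquationalFilterPair P in
    (A : Structure Sg) →
    (Σ[ Ξ ∈ (Subset A → Co K A) ] IsLeftAdjoint A Ξ)
    × (∀ (Ξ : Subset A → Co K A) → IsLeftAdjoint A Ξ →
    ∀ (S : Subset A) → IsGeneratedBy (Ξ S) (τ-pairs A S))
proposition4p2 P A =
  -- A left adjoint is constructed first, so the claim about every left adjoint is not vacuous.
  ( (λ S → proj₁ (gen S))
  , λ {S} {ψ} → generated⇒adjoint P A (λ S → proj₁ (gen S)) (λ S → proj₂ (gen S)) {S} {ψ} )
  , adjoint⇒generated P A
  where
    open EquationalFilterPair P
    gen : ∀ S → Σ[ θ ∈ Co K A ] IsGeneratedBy θ (τ-pairs A S)
    gen S = generated isQuasivariety (τ-pairs A S)
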